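{- There is a computable tree $T\subseteq\mathbb N^{<\omega}$ that is finitely branching and has exactly one branch $f:\mathbb N\to\mathbb N$, and this branch satisfies $\emptyset'\le_{\mathsf T}f$.
   Context: $\mathbb N^{<\omega}$ is the set of finite sequences of natural numbers; $\sigma\sqsubset\tau$ means that $\sigma$ is a proper initial segment of $\tau$, and $\sigma\star i$ is the extension of $\sigma$ by one further entry $i$. A tree is a set $T\subseteq\mathbb N^{<\omega}$ such that $\sigma\sqsubset\tau\in T$ entails $\sigma\in T$. A branch of $T$ is a function $f:\mathbb N\to\mathbb N$ with $\langle f(0),\ldots,f(n-1)\rangle\in T$ for all $n\in\mathbb N$. A tree $T$ is finitely branching if each $\sigma\in T$ admits an $N\in\mathbb N$ with $\sigma\star i\notin T$ for all $i\ge N$. Via a fixed primitive recursive coding of finite sequences by natural numbers, trees are viewed as subsets of $\mathbb N$, so that computability applies to them. $Y\le_{\mathsf T}Z$ means that the characteristic function of $Y$ is computable with oracle $Z$; a function $f:\mathbb N\to\mathbb N$ is identified with its coded graph $\{\pi(m,n)\mid f(m)=n\}$, where $\pi:\mathbb N^2\to\mathbb N$ is the Cantor pairing function. The set $\emptyset'$ is the halting set $\{\pi(e,n)\mid\{e\}(n)\text{ is defined}\}$, where $\{e\}$ is the partial computable function computed by the program with code $e$. -}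

module Defs where

open import Data.List.Base using (List; []; _∷_; _∷ʳ_; applyUpTo)
open import Data.List.Relation.Binary.Prefix.Heterogeneous using (Prefix)
open import Data.Nat.Base using (ℕ; zero; suc; _+_; _*_; _/_; _≤_; _<_)
open import Data.Product.Base using (_×_; ∃; ∃-syntax; ∃₂)
open import Data.Sum.Base using (_⊎_)
open import Level using (0ℓ)
open import Relation.Binary.Core using (Rel)
open import Relation.Binary.PropositionalEquality.Core using (_≡_; _≢_)
open import Relation.Nullary.Negation.Core using (¬_)
open import Relation.Unary using (Pred; ∅)

infix 4 _≤T_ _⊏_
infixl 5 _⋆_

-- The Cantor pairing function, a bijection ℕ × ℕ → ℕ.

π : ℕ → ℕ → ℕ
π m n = (m + n) * suc (m + n) / 2 + n

-- Kleene's partial recursive functions relative to an oracle.  All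
-- functions are unary; several arguments are passed as a single number
-- by means of π.

data Program : Set where
  zeroᵖ sucᵖ fstᵖ sndᵖ oracle : Program
  pair comp prec              : Program → Program → Program
  mu                          : Program → Program

-- A partial function on ℕ is represented by its graph.

χ : Pred ℕ 0ℓ → Rel ℕ 0ℓ
χ Z x y = (Z x × y ≡ 1) ⊎ (¬ Z x × y ≡ 0)

-- h(a,0) = F(a),  h(a,n+1) = G(π(a,π(n,h(a,n))))

primRec : Rel ℕ 0ℓ → Rel ℕ 0ℓ → ℕ → Rel ℕ 0ℓ
primRec F G a zero    y = F a y
primRec F G a (suc n) y = ∃[ r ] primRec F G a n r × G (π a (π n r)) y

-- ⟦ p ⟧ Z x y: with oracle Z, program p halts on input x with output y.

⟦_⟧ : Program → Pred ℕ 0ℓ → Rel ℕ 0ℓ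
⟦ zeroᵖ    ⟧ Z x y = y ≡ 0
⟦ sucᵖ     ⟧ Z x y = y ≡ suc x
⟦ fstᵖ     ⟧ Z x y = ∃[ b ] x ≡ π y b
⟦ sndᵖ     ⟧ Z x y = ∃[ a ] x ≡ π a y
⟦ oracle   ⟧ Z x y = χ Z x y
⟦ pair p q ⟧ Z x y = ∃₂ λ a b → ⟦ p ⟧ Z x a × ⟦ q ⟧ Z x b × y ≡ π a b
⟦ comp p q ⟧ Z x y = ∃[ z ] ⟦ q ⟧ Z x z × ⟦ p ⟧ Z z y
⟦ prec p q ⟧ Z x y =
  ∃₂ λ a n → x ≡ π a n × primRec (⟦ p ⟧ Z) (⟦ q ⟧ Z) a n y
⟦ mu p     ⟧ Z x y =
  ⟦ p ⟧ Z (π x y) 0 × (∀ i → i < y → ∃[ k ] ⟦ p ⟧ Z (π x i) (suc k))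

programCode : Program → ℕ
programCode zeroᵖ      = π 0 0
programCode sucᵖ       = π 1 0
programCode fstᵖ       = π 2 0
programCode sndᵖ       = π 3 0
programCode oracle     = π 4 0
programCode (pair p q) = π 5 (π (programCode p) (programCode q))
programCode (comp p q) = π 6 (π (programCode p) (programCode q))
programCode (prec p q) = π 7 (π (programCode p) (programCode q))
programCode (mu p)     = π 8 (programCode p)

-- φ e is the graph of {e}.  Computability without an oracle is
-- computability with the empty oracle; if e is not the code of a
-- program, then {e} is nowhere defined.

φ : ℕ → Rel ℕ 0ℓ
φ e x y = ∃[ p ] programCode p ≡ e × ⟦ p ⟧ ∅ x y

∅′ : Pred ℕ 0ℓ
∅′ x = ∃₂ λ e n → x ≡ π e n × ∃[ y ] φ e n y

-- Programs are deterministic, so ⟦ p ⟧ Z is then exactly χ Y whenever χ Y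
-- is total, i.e. whenever membership in Y is decided (as it always is
-- classically).

_≤T_ : Pred ℕ 0ℓ → Pred ℕ 0ℓ → Set
Y ≤T Z = ∃[ p ] ∀ x y → χ Y x y → ⟦ p ⟧ Z x y

Computable : Pred ℕ 0ℓ → Set
Computable Y = Y ≤T ∅

graph : (ℕ → ℕ) → Pred ℕ 0ℓ
graph f x = ∃₂ λ m n → x ≡ π m n × f m ≡ n

sequenceCode : List ℕ → ℕ
sequenceCode []      = 0
sequenceCode (i ∷ σ) = suc (π i (sequenceCode σ))

codes : Pred (List ℕ) 0ℓ → Pred ℕ 0ℓ
codes T x = ∃[ σ ] x ≡ sequenceCode σ × T σ

_⊏_ : Rel (List ℕ) 0ℓ
σ ⊏ τ = Prefix _≡_ σ τ × σ ≢ τ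

_⋆_ : List ℕ → ℕ → List ℕ
_⋆_ = _∷ʳ_

IsTree : Pred (List ℕ) 0ℓ → Set
IsTree T = ∀ σ τ → σ ⊏ τ → T τ → T σ

IsBranch : Pred (List ℕ) 0ℓ → (ℕ → ℕ) → Set
IsBranch T f = ∀ n → T (applyUpTo f n)

FinitelyBranching : Pred (List ℕ) 0ℓ → Set
FinitelyBranching T = ∀ σ → T σ → ∃[ N ] ∀ i → N ≤ i → ¬ T (σ ⋆ i)

{-# OPTIONS --safe #-}

-- The facts {e}(x) = y are generated by an inference system whose
-- derivations can be checked primitive recursively, so that x ∈ ∅′ iff some
-- number w witnesses it, which is decidable.  Let f x be 0 if x has no
-- witness, and 1 + w for the least witness w otherwise.  A sequence σ is in
-- the tree if each positive entry of σ names the least witness for its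
-- position, and no position with entry 0 has a witness below the code of σ.
-- As the code grows along a branch, f is the only branch; and an entry can
-- only be 0 or the correct value, so the tree is finitely branching.

module Submission where

open import Defs
open import Axiom.ExcludedMiddle using (ExcludedMiddle)
open import Data.Fin.Base using (Fin; zero; suc; toℕ)
open import Data.Fin.Patterns
open import Data.List.Base using (List; []; _∷_; [_]; _++_; applyUpTo; drop; foldl; length; lookup; map)
open import Data.List.Properties using (foldl-++)
open import Data.List.Relation.Binary.Prefix.Heterogeneous using (Prefix; []; _∷_)
open import Data.List.Relation.Unary.All as All using (All; []; _∷_)
open import Data.List.Membership.Propositional.Properties using (∈-lookup)
open import Data.Nat.Base using (ℕ; zero; suc; pred; _+_; _*_; _∸_; _/_; _≤_; _<_; z≤n; s≤s)
open import Data.Nat.DivMod using (+-distrib-/-∣ʳ; m*n/n≡m; /-monoˡ-≤)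
open import Data.Nat.Divisibility using (n∣m*n)
open import Data.Nat.Properties
open import Data.Nat.Solver using (module +-*-Solver)
open import Data.Product.Base using (_×_; _,_; proj₁; proj₂; Σ-syntax; ∃-syntax; ∃₂; uncurry)
open import Data.Sum.Base using (_⊎_; inj₁; inj₂)
open import Data.Vec.Base as Vec using (Vec; []; _∷_)
open import Function.Base using (_∘_; id)
open import Level using (0ℓ)
open import Relation.Binary.Definitions using (tri<; tri≈; tri>)
open import Relation.Binary.PropositionalEquality
  using (_≡_; _≢_; _≗_; refl; sym; trans; cong; cong₂; subst; module ≡-Reasoning)
open import Relation.Nullary.Decidable.Core using (yes; no)
open import Relation.Nullary.Negation.Core using (¬_; contradiction)
open import Relation.Unary using (Pred; ∅)

-- The Cantor pairing function

nextPair : ℕ × ℕ → ℕ × ℕ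
nextPair (zero  , n) = suc n , 0
nextPair (suc m , n) = m , suc n

π-sucʳ : ∀ m n → π m (suc n) ≡ suc (π (suc m) n)
π-sucʳ m n rewrite +-suc m n = +-suc _ n

triangle-suc : ∀ m → suc m * suc (suc m) / 2 ≡ m * suc m / 2 + suc m
triangle-suc m = begin
  suc m * suc (suc m) / 2            ≡⟨ cong (_/ 2) (expand m) ⟩
  (m * suc m + suc m * 2) / 2        ≡⟨ +-distrib-/-∣ʳ (m * suc m) (n∣m*n (suc m)) ⟩
  m * suc m / 2 + suc m * 2 / 2      ≡⟨ cong (m * suc m / 2 +_) (m*n/n≡m (suc m) 2) ⟩
  m * suc m / 2 + suc m              ∎
  where
  open ≡-Reasoning
  open +-*-Solver
  expand : ∀ m → suc m * suc (suc m) ≡ m * suc m + suc m * 2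
  expand = solve 1 (λ m → (con 1 :+ m) :* (con 2 :+ m) := m :* (con 1 :+ m) :+ (con 1 :+ m) :* con 2) refl

π-wrap : ∀ m → π (suc m) 0 ≡ suc (π 0 m)
π-wrap m rewrite +-identityʳ m | +-identityʳ (suc m * suc (suc m) / 2) =
  trans (triangle-suc m) (+-suc _ m)

π-nextPair : ∀ mn → uncurry π (nextPair mn) ≡ suc (uncurry π mn)
π-nextPair (zero  , n) = π-wrap n
π-nextPair (suc m , n) = π-sucʳ m n

-- The inverse of `π` counts through the pairs diagonal by diagonal instead of extracting square
-- roots, so both inverse laws become inductions on the code.
unpair : ℕ → ℕ × ℕ
unpair zero    = 0 , 0
unpair (suc k) = nextPair (unpair k)

π₁ π₂ : ℕ → ℕ
π₁ = proj₁ ∘ unpair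
π₂ = proj₂ ∘ unpair

π-unpair : ∀ k → π (π₁ k) (π₂ k) ≡ k
π-unpair zero    = refl
π-unpair (suc k) = trans (π-nextPair (unpair k)) (cong suc (π-unpair k))

unpair-π : ∀ k m n → π m n ≡ k → unpair k ≡ (m , n)
unpair-π zero    zero    zero    _  = refl
unpair-π (suc k) zero    zero    ()
unpair-π zero    (suc m) zero    eq = contradiction (trans (sym (π-wrap m)) eq) λ ()
unpair-π (suc k) (suc m) zero    eq =
  cong nextPair (unpair-π k 0 m (suc-injective (trans (sym (π-wrap m)) eq)))
unpair-π zero    m       (suc n) eq = contradiction (trans (sym (π-sucʳ m n)) eq) λ ()
unpair-π (suc k) m       (suc n) eq =
  cong nextPair (unpair-π k (suc m) n (suc-injective (trans (sym (π-sucʳ m n)) eq)))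

π₁-π : ∀ m n → π₁ (π m n) ≡ m
π₁-π m n = cong proj₁ (unpair-π _ m n refl)

π₂-π : ∀ m n → π₂ (π m n) ≡ n
π₂-π m n = cong proj₂ (unpair-π _ m n refl)

π-injectiveˡ : ∀ {a b c d} → π a b ≡ π c d → a ≡ c
π-injectiveˡ {a} {b} {c} {d} eq = trans (sym (π₁-π a b)) (trans (cong π₁ eq) (π₁-π c d))

π-injectiveʳ : ∀ {a b c d} → π a b ≡ π c d → b ≡ d
π-injectiveʳ {a} {b} {c} {d} eq = trans (sym (π₂-π a b)) (trans (cong π₂ eq) (π₂-π c d))

n≤π : ∀ m n → n ≤ π m n
n≤π m n = m≤n+m n _

π-monoʳ-≤ : ∀ m {n o} → n ≤ o → π m n ≤ π m o
π-monoʳ-≤ m n≤o = +-mono-≤ (/-monoˡ-≤ 2 (*-mono-≤ le (s≤s le))) n≤o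
  where le = +-monoʳ-≤ m n≤o

-- Terms for primitive recursive functions

rec : ℕ → (ℕ → ℕ → ℕ) → ℕ → ℕ
rec b f zero    = b
rec b f (suc n) = f n (rec b f n)

infixl 9 _$_

-- A deep embedding: each definition yields both a value that reduces under `eval` and a program.
-- `_$_` calls a term as a subroutine, in place of a substitution operation.
data Term : ℕ → Set where
  var         : ∀ {n} → Fin n → Term n
  0ᵗ          : ∀ {n} → Term n
  sucᵗ        : ∀ {n} → Term n → Term n
  ⟨_,_⟩       : ∀ {n} → Term n → Term n → Term n
  fstᵗ sndᵗ   : ∀ {n} → Term n → Term n
  -- The step term sees the previous value as variable 0 and the counter
  -- as variable 1.
  recᵗ        : ∀ {n} → Term n → Term (2 + n) → Term n → Term n
  _$_         : ∀ {m n} → Term m → Vec (Term n) m → Term n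

eval  : ∀ {n} → Term n → Vec ℕ n → ℕ
evals : ∀ {m n} → Vec (Term n) m → Vec ℕ n → Vec ℕ m
eval (var i)      ρ = Vec.lookup ρ i
eval 0ᵗ           ρ = 0
eval (sucᵗ t)     ρ = suc (eval t ρ)
eval ⟨ t , u ⟩    ρ = π (eval t ρ) (eval u ρ)
eval (fstᵗ t)     ρ = π₁ (eval t ρ)
eval (sndᵗ t)     ρ = π₂ (eval t ρ)
eval (recᵗ b s n) ρ = rec (eval b ρ) (λ k r → eval s (r ∷ k ∷ ρ)) (eval n ρ)
eval (t $ us)     ρ = eval t (evals us ρ)
evals []       ρ = []
evals (t ∷ ts) ρ = eval t ρ ∷ evals ts ρ

-- Compilation of terms into programs

encode : ∀ {n} → Vec ℕ n → ℕ
encode []      = 0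
encode (x ∷ ρ) = π x (encode ρ)

varᵖ : ∀ {n} → Fin n → Program
varᵖ zero    = fstᵖ
varᵖ (suc i) = comp (varᵖ i) sndᵖ

-- As every number is a pair, taking it apart and pairing again is the identity. The step program of
-- `prec` receives parameter, counter and previous value in this order; `rotateᵖ` reverses it into
-- the environment of a step term.
idᵖ rotateᵖ : Program
idᵖ     = pair fstᵖ sndᵖ
rotateᵖ = pair (comp sndᵖ sndᵖ) (pair (comp fstᵖ sndᵖ) fstᵖ)

idᵖ-correct : ∀ Z x → ⟦ idᵖ ⟧ Z x x
idᵖ-correct Z x = π₁ x , π₂ x , (π₂ x , x≡) , (π₁ x , x≡) , x≡
  where x≡ = sym (π-unpair x)

rotateᵖ-correct : ∀ Z a k r → ⟦ rotateᵖ ⟧ Z (π a (π k r)) (π r (π k a))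
rotateᵖ-correct Z a k r =
  r , π k a , (π k r , (a , refl) , (k , refl)) ,
  (k , a , (π k r , (a , refl) , (r , refl)) , (π k r , refl) , refl) , refl

compile  : ∀ {n} → Term n → Program
compiles : ∀ {m n} → Vec (Term n) m → Program
compile (var i)      = varᵖ i
compile 0ᵗ           = zeroᵖ
compile (sucᵗ t)     = comp sucᵖ (compile t)
compile ⟨ t , u ⟩    = pair (compile t) (compile u)
compile (fstᵗ t)     = comp fstᵖ (compile t)
compile (sndᵗ t)     = comp sndᵖ (compile t)
compile (recᵗ b s n) =
  comp (prec (compile b) (comp (compile s) rotateᵖ)) (pair idᵖ (compile n))
compile (t $ us)     = comp (compile t) (compiles us)
compiles []       = zeroᵖ
compiles (t ∷ ts) = pair (compile t) (compiles ts)

varᵖ-correct : ∀ {n} (i : Fin n) Z ρ → ⟦ varᵖ i ⟧ Z (encode ρ) (Vec.lookup ρ i)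
varᵖ-correct zero    Z (x ∷ ρ) = encode ρ , refl
varᵖ-correct (suc i) Z (x ∷ ρ) = encode ρ , (x , refl) , varᵖ-correct i Z ρ

compile-correct  : ∀ {n} (t : Term n) Z ρ → ⟦ compile t ⟧ Z (encode ρ) (eval t ρ)
compiles-correct : ∀ {m n} (ts : Vec (Term n) m) Z ρ →
                   ⟦ compiles ts ⟧ Z (encode ρ) (encode (evals ts ρ))
rec-correct      : ∀ {n} (b : Term n) (s : Term (2 + n)) Z ρ k →
                   primRec (⟦ compile b ⟧ Z) (⟦ comp (compile s) rotateᵖ ⟧ Z)
                     (encode ρ) k (rec (eval b ρ) (λ k r → eval s (r ∷ k ∷ ρ)) k)
compile-correct (var i)      Z ρ = varᵖ-correct i Z ρ
compile-correct 0ᵗ           Z ρ = refl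
compile-correct (sucᵗ t)     Z ρ = _ , compile-correct t Z ρ , refl
compile-correct ⟨ t , u ⟩    Z ρ = _ , _ , compile-correct t Z ρ , compile-correct u Z ρ , refl
compile-correct (fstᵗ t)     Z ρ =
  _ , compile-correct t Z ρ , π₂ (eval t ρ) , sym (π-unpair (eval t ρ))
compile-correct (sndᵗ t)     Z ρ =
  _ , compile-correct t Z ρ , π₁ (eval t ρ) , sym (π-unpair (eval t ρ))
compile-correct (recᵗ b s n) Z ρ =
  π (encode ρ) (eval n ρ) ,
  (encode ρ , eval n ρ , idᵖ-correct Z (encode ρ) , compile-correct n Z ρ , refl) ,
  encode ρ , eval n ρ , refl , rec-correct b s Z ρ (eval n ρ)
compile-correct (t $ us)     Z ρ = _ , compiles-correct us Z ρ , compile-correct t Z (evals us ρ)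
compiles-correct []       Z ρ = refl
compiles-correct (t ∷ ts) Z ρ = _ , _ , compile-correct t Z ρ , compiles-correct ts Z ρ , refl
rec-correct b s Z ρ zero    = compile-correct b Z ρ
rec-correct b s Z ρ (suc k) =
  r , rec-correct b s Z ρ k , encode (r ∷ k ∷ ρ) ,
  rotateᵖ-correct Z (encode ρ) k r , compile-correct s Z (r ∷ k ∷ ρ)
  where r = rec (eval b ρ) (λ k r → eval s (r ∷ k ∷ ρ)) k

-- Arithmetic and logic in terms

pattern v0 = var 0F
pattern v1 = var 1F
pattern v2 = var 2F
pattern v3 = var 3F
pattern v4 = var 4F
pattern v5 = var 5F
pattern v6 = var 6F

num : ∀ {n} → ℕ → Term n
num zero    = 0ᵗ
num (suc k) = sucᵗ (num k)

ifZero : Term 3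
-- Previous value and counter occupy indices 0 and 1 of the step, so `v4` is the third argument.
ifZero = recᵗ v1 v4 v0

predᵗ : Term 1
predᵗ = recᵗ 0ᵗ v1 v0

-- Throughout, a term expresses a predicate by vanishing exactly where it holds. Thus `add` is
-- conjunction and `distance` is equality.
add monus distance : Term 2
add      = recᵗ v1 (sucᵗ v0) v0
monus    = recᵗ v0 (predᵗ $ (v0 ∷ [])) v1
distance = add $ (monus $ (v0 ∷ v1 ∷ []) ∷ monus $ (v1 ∷ v0 ∷ []) ∷ [])

eval-add : ∀ m n → eval add (m ∷ n ∷ []) ≡ m + n
eval-add zero    n = refl
eval-add (suc m) n = cong suc (eval-add m n)

eval-pred : ∀ n → eval predᵗ (n ∷ []) ≡ pred n
eval-pred zero    = refl
eval-pred (suc n) = refl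

eval-monus : ∀ m n → eval monus (m ∷ n ∷ []) ≡ m ∸ n
eval-monus m zero    = refl
eval-monus m (suc n) =
  trans (eval-pred (eval monus (m ∷ n ∷ []))) (trans (cong pred (eval-monus m n)) (pred[m∸n]≡m∸[1+n] m n))

eval-add≡0⁻ : ∀ m n → eval add (m ∷ n ∷ []) ≡ 0 → m ≡ 0 × n ≡ 0
eval-add≡0⁻ zero n eq = refl , eq

eval-add≡0⁺ : ∀ {m n} → m ≡ 0 → n ≡ 0 → eval add (m ∷ n ∷ []) ≡ 0
eval-add≡0⁺ refl n≡0 = n≡0

distance≡0⁻ : ∀ m n → eval distance (m ∷ n ∷ []) ≡ 0 → m ≡ n
distance≡0⁻ m n eq with m∸n≡0 , n∸m≡0 ← eval-add≡0⁻ _ _ eq =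
  ≤-antisym (m∸n≡0⇒m≤n (trans (sym (eval-monus m n)) m∸n≡0))
            (m∸n≡0⇒m≤n (trans (sym (eval-monus n m)) n∸m≡0))

distance≡0⁺ : ∀ {m n} → m ≡ n → eval distance (m ∷ n ∷ []) ≡ 0
distance≡0⁺ {m} refl = eval-add≡0⁺ m∸m≡0 m∸m≡0
  where m∸m≡0 = trans (eval-monus m m) (n∸n≡0 m)

-- An inference system for halting computations

-- Tag 0: input and output are irrelevant.  Tag 2: the part of the
-- meaning of mu which says that all arguments below output were rejected.

Holds : ℕ → ℕ → ℕ → ℕ → Set
Holds 0             e x y = ∃[ p ] programCode p ≡ e
Holds 1             e x y = φ e x y
Holds (suc (suc _)) e x y = ∀ i → i < y → ∃[ k ] φ e (π x i) (suc k)

record Fact (n : ℕ) : Set where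
  constructor fact
  field
    tag program input output : Term n

open Fact

factᵗ : ∀ {n} → Fact n → Term n
factᵗ (fact k e x y) = ⟨ k , ⟨ e , ⟨ x , y ⟩ ⟩ ⟩

HoldsAt : ∀ {n} → Fact n → Vec ℕ n → Set
HoldsAt (fact k e x y) ρ = Holds (eval k ρ) (eval e ρ) (eval x ρ) (eval y ρ)

infix 3 _,_⊢_

-- All rules have one shape, two premises over seven variables, so that a single term can check
-- every inference; shorter premise lists are padded with `trivial`.
record Rule : Set where
  constructor _,_⊢_
  field
    premise₁ premise₂ conclusion : Fact 7

open Rule

Sound : Rule → Set
Sound (P , Q ⊢ C) = ∀ ρ → HoldsAt P ρ → HoldsAt Q ρ → HoldsAt C ρ

-- A stack machine that checks derivations in reverse Polish notation

ifZero-elim : ∀ (P : ℕ → Set) c a b → (c ≡ 0 → P a) → P b → P (eval ifZero (c ∷ a ∷ b ∷ []))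
ifZero-elim P zero    a b pa pb = pa refl
ifZero-elim P (suc c) a b pa pb = pb

eval-ifZero-0 : ∀ {c} a b → c ≡ 0 → eval ifZero (c ∷ a ∷ b ∷ []) ≡ a
eval-ifZero-0 a b refl = refl

eval-ifZero-suc : ∀ {c n} a b → c ≡ suc n → eval ifZero (c ∷ a ∷ b ∷ []) ≡ b
eval-ifZero-suc a b refl = refl

unpack : ∀ {m} n → Term m → Vec (Term m) n
unpack zero    t = []
unpack (suc n) t = fstᵗ t ∷ unpack n (sndᵗ t)

evals-unpack : ∀ {m n} (t : Term m) ρ (σ : Vec ℕ n) → eval t ρ ≡ encode σ → evals (unpack n t) ρ ≡ σ
evals-unpack t ρ []      _  = refl
evals-unpack t ρ (x ∷ σ) eq = cong₂ _∷_
  (trans (cong π₁ eq) (π₁-π x (encode σ)))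
  (evals-unpack (sndᵗ t) ρ σ (trans (cong π₂ eq) (π₂-π x (encode σ))))

select : ∀ {m} → List (Term m) → Term m → Term m
-- The default 0 will code a true fact, so an index out of range does no harm.
select []       i = 0ᵗ
select (t ∷ ts) i = ifZero $ (i ∷ t ∷ select ts (predᵗ $ (i ∷ [])) ∷ [])

module _ {A : Set} {m : ℕ} (ρ : Vec ℕ m) where

  eval-select : ∀ (xs : List A) i (k : Fin (length xs)) → eval i ρ ≡ toℕ k →
                ∀ (g : A → Term m) → eval (select (map g xs) i) ρ ≡ eval (g (lookup xs k)) ρ
  eval-select (x ∷ xs) i zero    eq g = eval-ifZero-0 _ _ eq
  eval-select (x ∷ xs) i (suc k) eq g = trans (eval-ifZero-suc (eval (g x) ρ) _ eq)
    (eval-select xs (predᵗ $ (i ∷ [])) k (trans (eval-pred (eval i ρ)) (cong pred eq)) g)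

  -- The alternative is settled before `g` is chosen, because premises and conclusion are selected
  -- separately and must belong to the same rule.
  select-cases : ∀ (xs : List A) i → (∃[ k ] eval i ρ ≡ toℕ {length xs} k) ⊎
                 (∀ (g : A → Term m) → eval (select (map g xs) i) ρ ≡ 0)
  select-cases []       i = inj₂ λ _ → refl
  select-cases (x ∷ xs) i = split (eval i ρ) refl
    where
    split : ∀ n → eval i ρ ≡ n → (∃[ k ] eval i ρ ≡ toℕ {length (x ∷ xs)} k) ⊎
            (∀ (g : A → Term m) → eval (select (map g (x ∷ xs)) i) ρ ≡ 0)
    split zero    eq = inj₁ (zero , eq)
    split (suc n) eq with select-cases xs (predᵗ $ (i ∷ []))
    ... | inj₁ (k , eq′) = inj₁ (suc k , trans eq (cong suc
            (trans (sym (trans (eval-pred (eval i ρ)) (cong pred eq))) eq′)))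
    ... | inj₂ none      = inj₂ λ g → trans (eval-ifZero-suc (eval (g x) ρ) _ eq) (none g)

module ProofChecker (rules : List Rule) where

  data Derivable : ℕ → Set where
    axiom : Derivable 0
    infer : ∀ (r : Fin (length rules)) ρ → (let P , Q ⊢ C = lookup rules r) →
            Derivable (eval (factᵗ P) ρ) → Derivable (eval (factᵗ Q) ρ) →
            Derivable (eval (factᵗ C) ρ)

  -- Token 0 pushes the trivial fact; token π (suc r) (encode ρ) applies
  -- rule r, instantiated by ρ, to the two topmost facts.

  token : Fin (length rules) → Vec ℕ 7 → ℕ
  token r ρ = π (suc (toℕ r)) (encode ρ)

  instanceᵗ : (Rule → Fact 7) → Rule → Term 1
  instanceᵗ part r = factᵗ (part r) $ unpack 7 (sndᵗ v0)

  partᵗ : (Rule → Fact 7) → Term 1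
  partᵗ part = select (map (instanceᵗ part) rules) (predᵗ $ (fstᵗ v0 ∷ []))

  eval-partᵗ : ∀ part r ρ → eval (partᵗ part) (token r ρ ∷ []) ≡ eval (factᵗ (part (lookup rules r))) ρ
  eval-partᵗ part r ρ = trans
    (eval-select (token r ρ ∷ []) rules (predᵗ $ (fstᵗ v0 ∷ [])) r
      (trans (eval-pred (π₁ (token r ρ))) (cong pred (π₁-π (suc (toℕ r)) (encode ρ)))) (instanceᵗ part))
    (cong (eval (factᵗ (part (lookup rules r))))
      (evals-unpack (sndᵗ v0) (token r ρ ∷ []) ρ (π₂-π (suc (toℕ r)) (encode ρ))))

  -- Arbitrary numbers `i` are covered, not only values of `token`: any `i` decodes either to an
  -- instance of a rule or to an index out of range, where the conclusion is the axiom.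
  partᵗ-sound : ∀ i → Derivable (eval (partᵗ premise₁) (i ∷ [])) → Derivable (eval (partᵗ premise₂) (i ∷ [])) →
                Derivable (eval (partᵗ conclusion) (i ∷ []))
  partᵗ-sound i d₁ d₂ with select-cases (i ∷ []) rules (predᵗ $ (fstᵗ v0 ∷ []))
  ... | inj₁ (k , eq) = subst Derivable (sym (part≡ conclusion))
          (infer k _ (subst Derivable (part≡ premise₁) d₁) (subst Derivable (part≡ premise₂) d₂))
    where
    part≡ : ∀ part → eval (partᵗ part) (i ∷ []) ≡
            eval (factᵗ (part (lookup rules k))) (evals (unpack 7 (sndᵗ v0)) (i ∷ []))
    part≡ part = eval-select (i ∷ []) rules (predᵗ $ (fstᵗ v0 ∷ [])) k eq (instanceᵗ part)
  ... | inj₂ none     = subst Derivable (sym (none (instanceᵗ conclusion))) axiom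

  -- The whole stack `v1` is compared with the one that has the two premises on top of its own
  -- remainder. If they differ, the stack is left as it is.
  inferᵗ stepᵗ : Term 2
  inferᵗ = ifZero $
    ( (distance $ (v1 ∷ ⟨ partᵗ premise₁ $ (v0 ∷ []) , ⟨ partᵗ premise₂ $ (v0 ∷ []) , sndᵗ (sndᵗ v1) ⟩ ⟩ ∷ []))
    ∷ ⟨ partᵗ conclusion $ (v0 ∷ []) , sndᵗ (sndᵗ v1) ⟩
    ∷ v1 ∷ [])
  stepᵗ = ifZero $ (fstᵗ v0 ∷ ⟨ 0ᵗ , v1 ⟩ ∷ inferᵗ ∷ [])

  step : ℕ → ℕ → ℕ
  step s i = eval stepᵗ (i ∷ s ∷ [])

  entry : ℕ → ℕ → ℕ
  entry zero    s = π₁ s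
  entry (suc k) s = entry k (π₂ s)

  -- Stacks have no bottom: as 0 is `π 0 0`, the empty stack unfolds into copies of the axiom, and
  -- underflow is harmless.
  DerivableStack : ℕ → Set
  DerivableStack s = ∀ k → Derivable (entry k s)

  push : ∀ u s → Derivable u → DerivableStack s → DerivableStack (π u s)
  push u s d ds zero    = subst Derivable (sym (π₁-π u s)) d
  push u s d ds (suc k) = subst (Derivable ∘ entry k) (sym (π₂-π u s)) (ds k)

  empty-stack : DerivableStack 0
  empty-stack zero    = axiom
  empty-stack (suc k) = empty-stack k

  step-sound : ∀ i s → DerivableStack s → DerivableStack (step s i)
  step-sound i s ds = ifZero-elim DerivableStack (π₁ i) (π 0 s) (eval inferᵗ (i ∷ s ∷ []))
    (λ _ → push 0 s axiom ds)
    (ifZero-elim DerivableStack (eval distance (s ∷ π P (π Q s₂) ∷ [])) (π C s₂) s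
      (λ s≡ → apply (distance≡0⁻ s (π P (π Q s₂)) s≡)) ds)
    where
    P Q C s₂ : ℕ
    P = eval (partᵗ premise₁) (i ∷ [])
    Q = eval (partᵗ premise₂) (i ∷ [])
    C = eval (partᵗ conclusion) (i ∷ [])
    s₂ = π₂ (π₂ s)
    apply : s ≡ π P (π Q s₂) → DerivableStack (π C s₂)
    apply s≡ = push C s₂
      (partᵗ-sound i
        (subst Derivable (trans (cong π₁ s≡) (π₁-π P (π Q s₂))) (ds 0))
        (subst Derivable
          (trans (cong π₁ (trans (cong π₂ s≡) (π₂-π P (π Q s₂)))) (π₁-π Q s₂)) (ds 1)))
      (ds ∘ (2 +_))

  step-push : ∀ s → step s 0 ≡ π 0 s
  step-push s = refl

  step-infer : ∀ r ρ s → (let P , Q ⊢ C = lookup rules r) →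
               step (π (eval (factᵗ P) ρ) (π (eval (factᵗ Q) ρ) s)) (token r ρ) ≡ π (eval (factᵗ C) ρ) s
  step-infer r ρ s = begin
    step s₀ (token r ρ)
      ≡⟨ eval-ifZero-suc (π 0 s₀) (eval inferᵗ (token r ρ ∷ s₀ ∷ [])) (π₁-π (suc (toℕ r)) (encode ρ)) ⟩
    eval inferᵗ (token r ρ ∷ s₀ ∷ [])
      ≡⟨ eval-ifZero-0 (π (part conclusion) s₂) s₀ (distance≡0⁺ (sym s₀≡)) ⟩
    π (part conclusion) s₂
      ≡⟨ cong₂ π (eval-partᵗ conclusion r ρ) s₂≡s ⟩
    π (P conclusion) s ∎
    where
    open ≡-Reasoning
    P part : (Rule → Fact 7) → ℕ
    P sel = eval (factᵗ (sel (lookup rules r))) ρ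
    part sel = eval (partᵗ sel) (token r ρ ∷ [])
    s₀ s₂ : ℕ
    s₀ = π (P premise₁) (π (P premise₂) s)
    s₂ = π₂ (π₂ s₀)
    s₂≡s : s₂ ≡ s
    s₂≡s = trans (cong π₂ (π₂-π (P premise₁) (π (P premise₂) s))) (π₂-π (P premise₂) s)
    s₀≡ : π (part premise₁) (π (part premise₂) s₂) ≡ s₀
    s₀≡ = cong₂ π (eval-partᵗ premise₁ r ρ) (cong₂ π (eval-partᵗ premise₂ r ρ) s₂≡s)

  derivation : ∀ {u} → Derivable u → List ℕ
  derivation axiom = [ 0 ]
  -- The second premise is derived first, which leaves the first one on top.
  derivation (infer r ρ d₁ d₂) = derivation d₂ ++ derivation d₁ ++ [ token r ρ ]

  foldl-derivation : ∀ {u} (d : Derivable u) s → foldl step s (derivation d) ≡ π u s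
  foldl-derivation axiom             s = step-push s
  foldl-derivation (infer r ρ d₁ d₂) s = begin
    foldl step s (is₂ ++ is₁ ++ [ i ])
      ≡⟨ foldl-++ step s is₂ (is₁ ++ [ i ]) ⟩
    foldl step (foldl step s is₂) (is₁ ++ [ i ])
      ≡⟨ foldl-++ step (foldl step s is₂) is₁ [ i ] ⟩
    step (foldl step (foldl step s is₂) is₁) i
      ≡⟨ cong (λ z → step (foldl step z is₁) i) (foldl-derivation d₂ s) ⟩
    step (foldl step (π Q s) is₁) i
      ≡⟨ cong (λ z → step z i) (foldl-derivation d₁ (π Q s)) ⟩
    step (π P (π Q s)) i
      ≡⟨ step-infer r ρ s ⟩
    π (eval (factᵗ (conclusion (lookup rules r))) ρ) s ∎
    where
    open ≡-Reasoning
    is₁ = derivation d₁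
    is₂ = derivation d₂
    i   = token r ρ
    P   = eval (factᵗ (premise₁ (lookup rules r))) ρ
    Q   = eval (factᵗ (premise₂ (lookup rules r))) ρ

  nextᵗ : Term 1
  nextᵗ = ⟨ sndᵗ (fstᵗ v0) , stepᵗ $ (fstᵗ (fstᵗ v0) ∷ sndᵗ v0 ∷ []) ⟩

  next : ℕ → ℕ
  next st = eval nextᵗ (st ∷ [])

  iterate : ℕ → ℕ → ℕ
  iterate n st = rec st (λ _ → next) n

  iterate-next : ∀ n st → iterate n (next st) ≡ iterate (suc n) st
  iterate-next zero    st = refl
  iterate-next (suc n) st = cong next (iterate-next n st)

  -- Unlike `sequenceCode`, this does not record the length, so `run` takes the number of steps as a
  -- separate argument.
  encodeList : List ℕ → ℕ
  encodeList []       = 0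
  encodeList (i ∷ is) = π i (encodeList is)

  next-π : ∀ i u s → next (π (π i u) s) ≡ π u (step s i)
  next-π i u s = cong₂ π (trans (cong π₂ top) (π₂-π i u))
    (cong₂ step (π₂-π (π i u) s) (trans (cong π₁ top) (π₁-π i u)))
    where top = π₁-π (π i u) s

  iterate-foldl : ∀ is s → π₂ (iterate (length is) (π (encodeList is) s)) ≡ foldl step s is
  iterate-foldl []       s = π₂-π 0 s
  iterate-foldl (i ∷ is) s = begin
    π₂ (iterate (suc (length is)) (π (π i (encodeList is)) s))
      ≡⟨ cong π₂ (iterate-next (length is) _) ⟨
    π₂ (iterate (length is) (next (π (π i (encodeList is)) s)))
      ≡⟨ cong (π₂ ∘ iterate (length is)) (next-π i (encodeList is) s) ⟩
    π₂ (iterate (length is) (π (encodeList is) (step s i)))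
      ≡⟨ iterate-foldl is (step s i) ⟩
    foldl step (step s i) is ∎
    where open ≡-Reasoning

  iterate-sound : ∀ n st → DerivableStack (π₂ st) → DerivableStack (π₂ (iterate n st))
  iterate-sound zero    st ds = ds
  iterate-sound (suc n) st ds =
    subst DerivableStack (sym (π₂-π (π₂ (π₁ st′)) (step (π₂ st′) (π₁ (π₁ st′)))))
      (step-sound (π₁ (π₁ st′)) (π₂ st′) (iterate-sound n st ds))
    where st′ = iterate n st

  runᵗ : Term 2
  runᵗ = sndᵗ (recᵗ ⟨ v1 , 0ᵗ ⟩ (nextᵗ $ (v0 ∷ [])) v0)

  run : ℕ → ℕ → ℕ
  run n u = eval runᵗ (n ∷ u ∷ [])

  run-sound : ∀ n u → DerivableStack (run n u)
  run-sound n u = iterate-sound n (π u 0) (subst DerivableStack (sym (π₂-π u 0)) empty-stack)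

  opaque
    -- Here `v1` pairs a number of steps with an encoded token list, and the final stack must hold
    -- just the fact `v0`. Being opaque, the term enters later proofs only through `check-sound` and
    -- `check-complete`.
    checkᵗ : Term 2
    checkᵗ = distance $ (runᵗ $ (fstᵗ v1 ∷ sndᵗ v1 ∷ []) ∷ ⟨ v0 , 0ᵗ ⟩ ∷ [])

  Checks : ℕ → ℕ → Set
  Checks u v = eval checkᵗ (u ∷ v ∷ []) ≡ 0

  opaque
    unfolding checkᵗ

    check-sound : ∀ u v → Checks u v → Derivable u
    check-sound u v eq = subst Derivable
      (trans (cong π₁ (distance≡0⁻ (run (π₁ v) (π₂ v)) (π u 0) eq)) (π₁-π u 0))
      (run-sound (π₁ v) (π₂ v) 0)

    check-complete : ∀ u → Derivable u → ∃[ v ] Checks u v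
    check-complete u d = v , distance≡0⁺ run≡
      where
      is : List ℕ
      is = derivation d
      v : ℕ
      v = π (length is) (encodeList is)
      run≡ : run (π₁ v) (π₂ v) ≡ π u 0
      run≡ = begin
        run (π₁ v) (π₂ v)
          ≡⟨ cong₂ run (π₁-π (length is) (encodeList is)) (π₂-π (length is) (encodeList is)) ⟩
        run (length is) (encodeList is)
          ≡⟨ iterate-foldl is 0 ⟩
        foldl step 0 is
          ≡⟨ foldl-derivation d 0 ⟩
        π u 0 ∎
        where open ≡-Reasoning

-- 0 = π 0 (π 0 (π 0 0)) encodes the true fact that 0 = programCode zeroᵖ
-- is the code of a program.

trivial : ∀ {n} → Fact n
trivial = fact 0ᵗ 0ᵗ 0ᵗ 0ᵗ

module _ where
  private
    sgᵗ k p q x y z w : Term 7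
    -- Reducing the first rule variable to 0 or 1 lets one rule serve these two tags while excluding
    -- tag 2.
    sgᵗ = ifZero $ (v0 ∷ num 0 ∷ num 1 ∷ [])
    k = sgᵗ
    p = v1
    q = v2
    x = v3
    y = v4
    z = v5
    w = v6

  -- With tag 0 the rules for evaluation turn into formation rules for
  -- program codes.

  rules : List Rule
  rules =
    (trivial , trivial ⊢ fact k (num (π 0 0)) x 0ᵗ) ∷
    -- The evaluation rule for `sucᵖ` has a positive output, whereas `derive-code` wants output 0;
    -- hence a separate formation rule.
    (trivial , trivial ⊢ fact 0ᵗ (num (π 1 0)) 0ᵗ 0ᵗ) ∷
    (trivial , trivial ⊢ fact (num 1) (num (π 1 0)) x (sucᵗ x)) ∷
    (trivial , trivial ⊢ fact k (num (π 2 0)) ⟨ x , y ⟩ x) ∷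
    (trivial , trivial ⊢ fact k (num (π 3 0)) ⟨ x , y ⟩ y) ∷
    (trivial , trivial ⊢ fact k (num (π 4 0)) x 0ᵗ) ∷
    (fact k p x y , fact k q x z ⊢ fact k ⟨ num 5 , ⟨ p , q ⟩ ⟩ x ⟨ y , z ⟩) ∷
    (fact k p z y , fact k q x z ⊢ fact k ⟨ num 6 , ⟨ p , q ⟩ ⟩ x y) ∷
    -- At counter 0 the program coded by `q` is never run, but `q` must still be the code of a
    -- program. Tag 0 supplies this.
    (fact k p x y , fact 0ᵗ q 0ᵗ 0ᵗ ⊢ fact k ⟨ num 7 , ⟨ p , q ⟩ ⟩ ⟨ x , 0ᵗ ⟩ y) ∷
    -- The value at the previous counter is itself a fact about the same `prec` program.
    (fact (num 1) ⟨ num 7 , ⟨ p , q ⟩ ⟩ ⟨ x , z ⟩ w , fact (num 1) q ⟨ x , ⟨ z , w ⟩ ⟩ y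
      ⊢ fact (num 1) ⟨ num 7 , ⟨ p , q ⟩ ⟩ ⟨ x , sucᵗ z ⟩ y) ∷
    (trivial , trivial ⊢ fact (num 2) p x 0ᵗ) ∷
    (fact (num 2) p x y , fact (num 1) p ⟨ x , y ⟩ (sucᵗ z) ⊢ fact (num 2) p x (sucᵗ y)) ∷
    (fact (num 2) p x y , fact k p ⟨ x , y ⟩ 0ᵗ ⊢ fact k ⟨ num 8 , p ⟩ x y) ∷
    []

-- Injectivity of program codes

constructorTag : Program → ℕ
constructorTag zeroᵖ      = 0
constructorTag sucᵖ       = 1
constructorTag fstᵖ       = 2
constructorTag sndᵖ       = 3
constructorTag oracle     = 4
constructorTag (pair p q) = 5
constructorTag (comp p q) = 6
constructorTag (prec p q) = 7
constructorTag (mu p)     = 8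

arguments : Program → ℕ
arguments (pair p q) = π (programCode p) (programCode q)
arguments (comp p q) = π (programCode p) (programCode q)
arguments (prec p q) = π (programCode p) (programCode q)
arguments (mu p)     = programCode p
arguments _          = 0

-- Comparing tags before arguments leaves only the nine diagonal cases of injectivity.
programCode≡π : ∀ p → programCode p ≡ π (constructorTag p) (arguments p)
programCode≡π zeroᵖ      = refl
programCode≡π sucᵖ       = refl
programCode≡π fstᵖ       = refl
programCode≡π sndᵖ       = refl
programCode≡π oracle     = refl
programCode≡π (pair p q) = refl
programCode≡π (comp p q) = refl
programCode≡π (prec p q) = refl
programCode≡π (mu p)     = refl

-- Facts about one code each provide some program with that code. Soundness for `prec` and `mu` has
-- to identify these programs.
programCode-injective : ∀ p q → programCode p ≡ programCode q → p ≡ q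

binary-injective : ∀ p q p′ q′ →
                   π (programCode p) (programCode q) ≡ π (programCode p′) (programCode q′) →
                   p ≡ p′ × q ≡ q′
binary-injective p q p′ q′ eq =
  programCode-injective p p′ (π-injectiveˡ {programCode p} {_} {programCode p′} eq) ,
  programCode-injective q q′ (π-injectiveʳ {programCode p} {_} {programCode p′} eq)

programCode-injective′ : ∀ p q → constructorTag p ≡ constructorTag q →
                         arguments p ≡ arguments q → p ≡ q
programCode-injective′ zeroᵖ      zeroᵖ        refl _  = refl
programCode-injective′ sucᵖ       sucᵖ         refl _  = refl
programCode-injective′ fstᵖ       fstᵖ         refl _  = refl
programCode-injective′ sndᵖ       sndᵖ         refl _  = refl
programCode-injective′ oracle     oracle       refl _  = refl
programCode-injective′ (pair p q) (pair p′ q′) refl eq with refl , refl ← binary-injective p q p′ q′ eq = refl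
programCode-injective′ (comp p q) (comp p′ q′) refl eq with refl , refl ← binary-injective p q p′ q′ eq = refl
programCode-injective′ (prec p q) (prec p′ q′) refl eq with refl , refl ← binary-injective p q p′ q′ eq = refl
programCode-injective′ (mu p)     (mu p′)      refl eq = cong mu (programCode-injective p p′ eq)

programCode-injective p q eq = programCode-injective′ p q
  (π-injectiveˡ {constructorTag p} {_} {constructorTag q} eq′)
  (π-injectiveʳ {constructorTag p} {_} {constructorTag q} eq′)
  where eq′ = trans (sym (programCode≡π p)) (trans eq (programCode≡π q))

programCode-prec⁻ : ∀ r d e → programCode r ≡ π 7 (π d e) →
                    ∃₂ λ p q → r ≡ prec p q × programCode p ≡ d × programCode q ≡ e
programCode-prec⁻ r d e eq = invert r
  (π-injectiveˡ {constructorTag r} {_} {7} {π d e} eq′) (π-injectiveʳ {constructorTag r} {_} {7} {π d e} eq′)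
  where
  eq′ = trans (sym (programCode≡π r)) eq
  invert : ∀ r → constructorTag r ≡ 7 → arguments r ≡ π d e →
           ∃₂ λ p q → r ≡ prec p q × programCode p ≡ d × programCode q ≡ e
  invert (prec p q) refl eq =
    p , q , refl , π-injectiveˡ {programCode p} {_} {d} {e} eq , π-injectiveʳ {programCode p} {_} {d} {e} eq

-- Soundness and completeness of the inference system

prec-suc : ∀ p q x n r y → ⟦ prec p q ⟧ ∅ (π x n) r → ⟦ q ⟧ ∅ (π x (π n r)) y →
           ⟦ prec p q ⟧ ∅ (π x (suc n)) y
prec-suc p q x n r y (a , m , x,n≡a,m , h) hq
  with refl ← π-injectiveˡ {x} {n} {a} {m} x,n≡a,m
     | refl ← π-injectiveʳ {x} {n} {a} {m} x,n≡a,m = x , suc n , refl , r , h , hq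

-- Matching on the first rule variable makes `sgᵗ` reduce and so separates formation from
-- evaluation.
rules-sound : All Sound rules
rules-sound =
  (λ { (zero  ∷ _) _ _ → zeroᵖ , refl
     ; (suc _ ∷ _) _ _ → zeroᵖ , refl , refl }) ∷
  (λ _ _ _ → sucᵖ , refl) ∷
  (λ _ _ _ → sucᵖ , refl , refl) ∷
  (λ { (zero  ∷ _) _ _ → fstᵖ , refl
     ; (suc _ ∷ _ ∷ _ ∷ _ ∷ y ∷ _) _ _ → fstᵖ , refl , y , refl }) ∷
  (λ { (zero  ∷ _) _ _ → sndᵖ , refl
     ; (suc _ ∷ _ ∷ _ ∷ x ∷ _) _ _ → sndᵖ , refl , x , refl }) ∷
  (λ { (zero  ∷ _) _ _ → oracle , refl
     ; (suc _ ∷ _) _ _ → oracle , refl , inj₂ ((λ ()) , refl) }) ∷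
  (λ { (zero  ∷ _ ∷ _ ∷ _) (p , refl) (q , refl) → pair p q , refl
     ; (suc _ ∷ _ ∷ _ ∷ _ ∷ y ∷ z ∷ _) (p , refl , hp) (q , refl , hq) →
         pair p q , refl , y , z , hp , hq , refl }) ∷
  (λ { (zero  ∷ _ ∷ _ ∷ _) (p , refl) (q , refl) → comp p q , refl
     ; (suc _ ∷ _ ∷ _ ∷ _ ∷ _ ∷ z ∷ _) (p , refl , hp) (q , refl , hq) →
         comp p q , refl , z , hq , hp }) ∷
  (λ { (zero  ∷ _ ∷ _ ∷ _) (p , refl) (q , refl) → prec p q , refl
     ; (suc _ ∷ _ ∷ _ ∷ x ∷ _) (p , refl , hp) (q , refl) →
         prec p q , refl , x , 0 , refl , hp }) ∷
  (λ { (_ ∷ d ∷ e ∷ x ∷ y ∷ z ∷ w ∷ []) (r , r≡ , hr) (q , q≡ , hq) →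
         precStep d e x y z w r r≡ hr q q≡ hq }) ∷
  (λ { _ _ _ i () }) ∷
  (λ { (_ ∷ e ∷ _ ∷ x ∷ y ∷ z ∷ _) below at i i<1+y → extend e x y z below at i (m<1+n⇒m<n∨m≡n i<1+y) }) ∷
  (λ { (zero  ∷ _ ∷ _) _ (p , refl) → mu p , refl
     ; (suc _ ∷ _ ∷ _ ∷ x ∷ y ∷ _) below (p , refl , hp) →
         mu p , refl , hp , λ i i<y → atCode p x i (below i i<y) }) ∷
  []
  where
  precStep : ∀ d e x y z w r → programCode r ≡ π 7 (π d e) → ⟦ r ⟧ ∅ (π x z) w →
             ∀ q → programCode q ≡ e → ⟦ q ⟧ ∅ (π x (π z w)) y → φ (π 7 (π d e)) (π x (suc z)) y
  precStep d e x y z w r r≡ hr q q≡ hq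
    with p , q′ , refl , p≡ , q′≡ ← programCode-prec⁻ r d e r≡
    with refl ← programCode-injective q q′ (trans q≡ (sym q′≡)) =
    prec p q , r≡ , prec-suc p q x z w y hr hq
  extend : ∀ e x y z → Holds 2 e x y → φ e (π x y) (suc z) →
           ∀ i → i < y ⊎ i ≡ y → ∃[ k ] φ e (π x i) (suc k)
  extend e x y z below at i (inj₁ i<y)  = below i i<y
  extend e x y z below at i (inj₂ refl) = z , at
  atCode : ∀ p x i → ∃[ k ] φ (programCode p) (π x i) (suc k) → ∃[ k ] ⟦ p ⟧ ∅ (π x i) (suc k)
  atCode p x i (k , q , q≡ , hq) with refl ← programCode-injective q p q≡ = k , hq

open ProofChecker rules

True : ℕ → Set
True u = Holds (π₁ u) (π₁ (π₂ u)) (π₁ (π₂ (π₂ u))) (π₂ (π₂ (π₂ u)))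

True≡Holds : ∀ k e x y → True (π k (π e (π x y))) ≡ Holds k e x y
True≡Holds k e x y
  rewrite π₁-π k (π e (π x y)) | π₂-π k (π e (π x y)) | π₁-π e (π x y) | π₂-π e (π x y)
        | π₁-π x y | π₂-π x y = refl

True-factᵗ : ∀ {n} (f : Fact n) ρ → True (eval (factᵗ f) ρ) ≡ HoldsAt f ρ
True-factᵗ (fact k e x y) ρ = True≡Holds (eval k ρ) (eval e ρ) (eval x ρ) (eval y ρ)

derivable⇒true : ∀ {u} → Derivable u → True u
derivable⇒true axiom = zeroᵖ , refl
derivable⇒true (infer r ρ d₁ d₂) with P , Q ⊢ C ← lookup rules r | sound ← All.lookup rules-sound (∈-lookup r) =
  subst id (sym (True-factᵗ C ρ))
    (sound ρ (subst id (True-factᵗ P ρ) (derivable⇒true d₁)) (subst id (True-factᵗ Q ρ) (derivable⇒true d₂)))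

-- Since `π 0 0` computes to 0, setting input, output and auxiliary variables to 0 makes premises
-- and conclusions fit this form.
derive-code : ∀ p → Derivable (π 0 (π (programCode p) 0))
derive-code zeroᵖ      = infer 0F (0 ∷ 0 ∷ 0 ∷ 0 ∷ 0 ∷ 0 ∷ 0 ∷ []) axiom axiom
derive-code sucᵖ       = infer 1F (0 ∷ 0 ∷ 0 ∷ 0 ∷ 0 ∷ 0 ∷ 0 ∷ []) axiom axiom
derive-code fstᵖ       = infer 3F (0 ∷ 0 ∷ 0 ∷ 0 ∷ 0 ∷ 0 ∷ 0 ∷ []) axiom axiom
derive-code sndᵖ       = infer 4F (0 ∷ 0 ∷ 0 ∷ 0 ∷ 0 ∷ 0 ∷ 0 ∷ []) axiom axiom
derive-code oracle     = infer 5F (0 ∷ 0 ∷ 0 ∷ 0 ∷ 0 ∷ 0 ∷ 0 ∷ []) axiom axiom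
derive-code (pair p q) =
  infer 6F (0 ∷ programCode p ∷ programCode q ∷ 0 ∷ 0 ∷ 0 ∷ 0 ∷ []) (derive-code p) (derive-code q)
derive-code (comp p q) =
  infer 7F (0 ∷ programCode p ∷ programCode q ∷ 0 ∷ 0 ∷ 0 ∷ 0 ∷ []) (derive-code p) (derive-code q)
derive-code (prec p q) =
  infer 8F (0 ∷ programCode p ∷ programCode q ∷ 0 ∷ 0 ∷ 0 ∷ 0 ∷ []) (derive-code p) (derive-code q)
derive-code (mu p)     =
  infer (suc (suc (suc 9F))) (0 ∷ programCode p ∷ 0 ∷ 0 ∷ 0 ∷ 0 ∷ 0 ∷ [])
    (infer (suc 9F) (0 ∷ programCode p ∷ 0 ∷ 0 ∷ 0 ∷ 0 ∷ 0 ∷ []) axiom axiom) (derive-code p)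

DerivableHalt : ℕ → ℕ → ℕ → Set
DerivableHalt e x y = Derivable (π 1 (π e (π x y)))

-- Recursion on the program, with inner recursions on the counter for `prec` and on the output for
-- `mu`. The vectors instantiate the rule variables, the first of which determines `k`, followed by
-- `p`, `q`, `x`, `y`, `z`, `w`.
derive      : ∀ p x y → ⟦ p ⟧ ∅ x y → DerivableHalt (programCode p) x y
derive-prec : ∀ p q a n y → primRec (⟦ p ⟧ ∅) (⟦ q ⟧ ∅) a n y →
              DerivableHalt (programCode (prec p q)) (π a n) y
derive-mu   : ∀ p x y → (∀ i → i < y → ∃[ k ] ⟦ p ⟧ ∅ (π x i) (suc k)) →
              Derivable (π 2 (π (programCode p) (π x y)))
derive zeroᵖ  x _ refl = infer 0F (1 ∷ 0 ∷ 0 ∷ x ∷ 0 ∷ 0 ∷ 0 ∷ []) axiom axiom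
derive sucᵖ   x _ refl = infer 2F (1 ∷ 0 ∷ 0 ∷ x ∷ 0 ∷ 0 ∷ 0 ∷ []) axiom axiom
derive fstᵖ   _ y (b , refl) = infer 3F (1 ∷ 0 ∷ 0 ∷ y ∷ b ∷ 0 ∷ 0 ∷ []) axiom axiom
derive sndᵖ   _ y (a , refl) = infer 4F (1 ∷ 0 ∷ 0 ∷ a ∷ y ∷ 0 ∷ 0 ∷ []) axiom axiom
derive oracle x _ (inj₂ (_ , refl)) = infer 5F (1 ∷ 0 ∷ 0 ∷ x ∷ 0 ∷ 0 ∷ 0 ∷ []) axiom axiom
derive (pair p q) x _ (a , b , hp , hq , refl) =
  infer 6F (1 ∷ programCode p ∷ programCode q ∷ x ∷ a ∷ b ∷ 0 ∷ []) (derive p x a hp) (derive q x b hq)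
derive (comp p q) x y (z , hq , hp) =
  infer 7F (1 ∷ programCode p ∷ programCode q ∷ x ∷ y ∷ z ∷ 0 ∷ []) (derive p z y hp) (derive q x z hq)
derive (prec p q) _ y (a , n , refl , h) = derive-prec p q a n y h
derive (mu p)     x y (hp , below) =
  infer (suc (suc (suc 9F))) (1 ∷ programCode p ∷ 0 ∷ x ∷ y ∷ 0 ∷ 0 ∷ [])
    (derive-mu p x y below) (derive p (π x y) 0 hp)
derive-prec p q a zero    y h =
  infer 8F (1 ∷ programCode p ∷ programCode q ∷ a ∷ y ∷ 0 ∷ 0 ∷ []) (derive p a y h) (derive-code q)
derive-prec p q a (suc n) y (r , h , hq) =
  infer 9F (0 ∷ programCode p ∷ programCode q ∷ a ∷ y ∷ n ∷ r ∷ [])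
    (derive-prec p q a n r h) (derive q (π a (π n r)) y hq)
derive-mu p x zero    _     =
  infer (suc 9F) (0 ∷ programCode p ∷ 0 ∷ x ∷ 0 ∷ 0 ∷ 0 ∷ []) axiom axiom
derive-mu p x (suc y) below with k , h ← below y ≤-refl =
  infer (suc (suc 9F)) (0 ∷ programCode p ∷ 0 ∷ x ∷ y ∷ k ∷ 0 ∷ [])
    (derive-mu p x y (λ i i<y → below i (m<n⇒m<1+n i<y))) (derive p (π x y) (suc k) h)

derivable⇒halts : ∀ e x y → DerivableHalt e x y → φ e x y
derivable⇒halts e x y d = subst id (True≡Holds 1 e x y) (derivable⇒true d)

halts⇒derivable : ∀ e x y → φ e x y → DerivableHalt e x y
halts⇒derivable e x y (p , refl , h) = derive p x y h

-- A witness for x = π e n is π y v, where v is a derivation of {e}(n) = y.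

haltingWitnessᵗ : Term 2
haltingWitnessᵗ = checkᵗ $ (factᵗ (fact (num 1) (fstᵗ v0) (sndᵗ v0) (fstᵗ v1)) ∷ sndᵗ v1 ∷ [])

HaltingWitness : ℕ → ℕ → Set
HaltingWitness x w = eval haltingWitnessᵗ (x ∷ w ∷ []) ≡ 0

witness⇒∅′ : ∀ x w → HaltingWitness x w → ∅′ x
witness⇒∅′ x w eq = π₁ x , π₂ x , sym (π-unpair x) , π₁ w ,
  derivable⇒halts (π₁ x) (π₂ x) (π₁ w)
    (check-sound (π 1 (π (π₁ x) (π (π₂ x) (π₁ w)))) (π₂ w) eq)

∅′⇒witness : ∀ x → ∅′ x → ∃[ w ] HaltingWitness x w
∅′⇒witness x (e , n , x≡ , y , h) =
  π y v , trans (cong₂ (λ u v → eval checkᵗ (u ∷ v ∷ [])) fact≡ (π₂-π y v)) (proj₂ checked)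
  where
  u = π 1 (π e (π n y))
  checked : ∃[ v ] Checks u v
  checked = check-complete u (halts⇒derivable e n y h)
  v = proj₁ checked
  fact≡ : π 1 (π (π₁ x) (π (π₂ x) (π₁ (π y v)))) ≡ u
  fact≡ = cong (π 1) (cong₂ π (trans (cong π₁ x≡) (π₁-π e n))
                              (cong₂ π (trans (cong π₂ x≡) (π₂-π e n)) (π₁-π y v)))

-- The tree of least witnesses

-- `pair idᵖ zeroᵖ` turns the input into a one-variable environment.
programᵗ : Term 1 → Program
programᵗ t = comp (compile t) (pair idᵖ zeroᵖ)

programᵗ-correct : ∀ t Z x → ⟦ programᵗ t ⟧ Z x (eval t (x ∷ []))
programᵗ-correct t Z x =
  π x 0 , (x , 0 , idᵖ-correct Z x , refl , refl) , compile-correct t Z (x ∷ [])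

notᵗ : Term 1
notᵗ = ifZero $ (v0 ∷ num 1 ∷ 0ᵗ ∷ [])

-- With 0 as truth, this is bounded universal quantification.
sum : (ℕ → ℕ) → ℕ → ℕ
sum g = rec 0 (λ k r → eval add (r ∷ g k ∷ []))

sum≡0⁺ : ∀ g n → (∀ k → k < n → g k ≡ 0) → sum g n ≡ 0
sum≡0⁺ g zero    g≡0 = refl
sum≡0⁺ g (suc n) g≡0 = eval-add≡0⁺ (sum≡0⁺ g n (λ k k<n → g≡0 k (m<n⇒m<1+n k<n))) (g≡0 n ≤-refl)

sum≡0⁻ : ∀ g n → sum g n ≡ 0 → ∀ k → k < n → g k ≡ 0
sum≡0⁻ g (suc n) eq k k<1+n with sum≡0 , gn≡0 ← eval-add≡0⁻ (sum g n) (g n) eq | m<1+n⇒m<n∨m≡n k<1+n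
... | inj₁ k<n  = sum≡0⁻ g n sum≡0 k k<n
... | inj₂ refl = gn≡0

-- Codes and entries of sequences

sequenceCode-surjective : ∀ x → ∃[ σ ] x ≡ sequenceCode σ
sequenceCode-surjective x = bounded x x ≤-refl
  where
  bounded : ∀ n x → x ≤ n → ∃[ σ ] x ≡ sequenceCode σ
  bounded n       zero    _       = [] , refl
  bounded (suc n) (suc x) (s≤s x≤n)
    with σ , eq ← bounded n (π₂ x) (≤-trans (subst (π₂ x ≤_) (π-unpair x) (n≤π (π₁ x) (π₂ x))) x≤n) =
    π₁ x ∷ σ , cong suc (trans (sym (π-unpair x)) (cong (π (π₁ x)) eq))

sequenceCode-mono : ∀ {σ τ} → Prefix _≡_ σ τ → sequenceCode σ ≤ sequenceCode τ
sequenceCode-mono []               = z≤n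
sequenceCode-mono (_∷_ {i} refl p) = s≤s (π-monoʳ-≤ i (sequenceCode-mono p))

-- That `σ` has entry `v` in position `k` is always expressed by `drop k σ ≡ v ∷ ρ`, the form that
-- `dropᵗ` computes on codes.
drop-prefix : ∀ {σ τ : List ℕ} → Prefix _≡_ σ τ → ∀ k {v ρ} → drop k σ ≡ v ∷ ρ → ∃[ ρ′ ] drop k τ ≡ v ∷ ρ′
drop-prefix []         zero    ()
drop-prefix []         (suc k) ()
drop-prefix (refl ∷ p) zero    refl = _ , refl
drop-prefix (refl ∷ p) (suc k) eq   = drop-prefix p k eq

-- Lets the tree test quantify over positions below the code, and makes codes unbounded along a
-- branch.
drop-<-sequenceCode : ∀ k σ {v ρ} → drop k σ ≡ v ∷ ρ → k < sequenceCode σ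
drop-<-sequenceCode zero    (i ∷ σ) eq = s≤s z≤n
drop-<-sequenceCode (suc k) (i ∷ σ) eq =
  s≤s (≤-trans (drop-<-sequenceCode k σ eq) (n≤π i (sequenceCode σ)))

drop-length-⋆ : ∀ σ i → drop (length σ) (σ ⋆ i) ≡ i ∷ []
drop-length-⋆ []      i = refl
drop-length-⋆ (_ ∷ σ) i = drop-length-⋆ σ i

drop-applyUpTo⁻ : ∀ (f : ℕ → ℕ) n k {v ρ} → drop k (applyUpTo f n) ≡ v ∷ ρ → v ≡ f k
drop-applyUpTo⁻ f zero    zero    ()
drop-applyUpTo⁻ f zero    (suc k) ()
drop-applyUpTo⁻ f (suc n) zero    refl = refl
drop-applyUpTo⁻ f (suc n) (suc k) eq   = drop-applyUpTo⁻ (f ∘ suc) n k eq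

drop-applyUpTo⁺ : ∀ (f : ℕ → ℕ) {n k} → k < n → ∃[ ρ ] drop k (applyUpTo f n) ≡ f k ∷ ρ
drop-applyUpTo⁺ f {suc n} {zero}  _         = _ , refl
drop-applyUpTo⁺ f {suc n} {suc k} (s≤s k<n) = drop-applyUpTo⁺ (f ∘ suc) k<n

drop-suc : ∀ k (σ : List ℕ) → drop 1 (drop k σ) ≡ drop (suc k) σ
drop-suc zero    σ       = refl
drop-suc (suc k) []      = refl
drop-suc (suc k) (_ ∷ σ) = drop-suc k σ

dropᵗ : Term 2
-- `predᵗ` strips the `suc` of `sequenceCode`. Both operations fix 0, the code of `[]`, so dropping
-- past the end agrees with `drop`.
dropᵗ = recᵗ v1 (sndᵗ (predᵗ $ (v0 ∷ []))) v0

eval-dropᵗ : ∀ k σ → eval dropᵗ (k ∷ sequenceCode σ ∷ []) ≡ sequenceCode (drop k σ)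
eval-dropᵗ zero    σ = refl
eval-dropᵗ (suc k) σ = trans (cong (λ c → π₂ (eval predᵗ (c ∷ []))) (eval-dropᵗ k σ))
  (trans (tail (drop k σ)) (cong sequenceCode (drop-suc k σ)))
  where
  tail : ∀ σ → π₂ (eval predᵗ (sequenceCode σ ∷ [])) ≡ sequenceCode (drop 1 σ)
  tail []      = refl
  tail (i ∷ σ) = π₂-π i (sequenceCode σ)

-- The construction works for any primitive recursive witness relation; halting enters only when
-- `witnessᵗ` is instantiated.
module LeastWitnessTree (em : ExcludedMiddle 0ℓ) (witnessᵗ : Term 2) where

  Witness : ℕ → ℕ → Set
  Witness x w = eval witnessᵗ (x ∷ w ∷ []) ≡ 0

  NoWitnessBelow : ℕ → ℕ → Set
  NoWitnessBelow x n = ∀ w → w < n → ¬ Witness x w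

  noWitnessᵗ : Term 2
  noWitnessᵗ = recᵗ 0ᵗ (add $ (v0 ∷ notᵗ $ (witnessᵗ $ (v2 ∷ v1 ∷ []) ∷ []) ∷ [])) v1

  noWitness⁺ : ∀ x n → NoWitnessBelow x n → eval noWitnessᵗ (x ∷ n ∷ []) ≡ 0
  noWitness⁺ x n none = sum≡0⁺ _ n λ w w<n → not≡0 _ (none w w<n)
    where
    not≡0 : ∀ m → m ≢ 0 → eval notᵗ (m ∷ []) ≡ 0
    not≡0 zero    m≢0 = contradiction refl m≢0
    not≡0 (suc m) m≢0 = refl

  noWitness⁻ : ∀ x n → eval noWitnessᵗ (x ∷ n ∷ []) ≡ 0 → NoWitnessBelow x n
  noWitness⁻ x n eq w w<n wit
    with () ← trans (sym (cong (λ m → eval notᵗ (m ∷ [])) wit)) (sum≡0⁻ _ n eq w w<n)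

  -- The condition on an entry v in position x of a sequence with code c,
  -- which serves as a bound exceeding all positions.

  Entry : ℕ → ℕ → ℕ → Set
  Entry x zero    c = NoWitnessBelow x c
  Entry x (suc w) c = Witness x w × NoWitnessBelow x w

  entryᵗ : Term 3
  entryᵗ = ifZero $
    ( v1
    ∷ noWitnessᵗ $ (v0 ∷ v2 ∷ [])
    ∷ add $ ( witnessᵗ $ (v0 ∷ predᵗ $ (v1 ∷ []) ∷ [])
            ∷ noWitnessᵗ $ (v0 ∷ predᵗ $ (v1 ∷ []) ∷ []) ∷ [])
    ∷ [])

  entry⁺ : ∀ x v c → Entry x v c → eval entryᵗ (x ∷ v ∷ c ∷ []) ≡ 0
  entry⁺ x zero    c none         = noWitness⁺ x c none
  entry⁺ x (suc w) c (wit , none) = eval-add≡0⁺ wit (noWitness⁺ x w none)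

  entry⁻ : ∀ x v c → eval entryᵗ (x ∷ v ∷ c ∷ []) ≡ 0 → Entry x v c
  entry⁻ x zero    c eq = noWitness⁻ x c eq
  entry⁻ x (suc w) c eq with wit , none ← eval-add≡0⁻ _ _ eq = wit , noWitness⁻ x w none

  Tree : Pred (List ℕ) 0ℓ
  Tree σ = ∀ k v ρ → drop k σ ≡ v ∷ ρ → Entry k v (sequenceCode σ)

  positionᵗ : Term 2
  positionᵗ = ifZero $
    ( dropᵗ
    -- A position past the end imposes no condition.
    ∷ 0ᵗ
    ∷ entryᵗ $ (v0 ∷ fstᵗ (predᵗ $ (dropᵗ ∷ [])) ∷ v1 ∷ [])
    ∷ [])

  treeᵗ : Term 1
  treeᵗ = recᵗ 0ᵗ (add $ (v0 ∷ positionᵗ $ (v1 ∷ v2 ∷ []) ∷ [])) v0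

  -- Abstracts the value of `dropᵗ` from `positionᵗ`, so that one `cong` rewrites both occurrences.
  positionOf : ℕ → List ℕ → ℕ → ℕ
  positionOf k σ d = eval ifZero
    (d ∷ 0 ∷ eval entryᵗ (k ∷ π₁ (eval predᵗ (d ∷ [])) ∷ sequenceCode σ ∷ []) ∷ [])

  eval-position : ∀ k σ → eval positionᵗ (k ∷ sequenceCode σ ∷ []) ≡ positionOf k σ (sequenceCode (drop k σ))
  eval-position k σ = cong (positionOf k σ) (eval-dropᵗ k σ)

  positionOf-∷ : ∀ k σ v ρ → positionOf k σ (sequenceCode (v ∷ ρ)) ≡ eval entryᵗ (k ∷ v ∷ sequenceCode σ ∷ [])
  positionOf-∷ k σ v ρ = cong (λ v → eval entryᵗ (k ∷ v ∷ sequenceCode σ ∷ [])) (π₁-π v (sequenceCode ρ))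

  tree⁺ : ∀ σ → Tree σ → eval treeᵗ (sequenceCode σ ∷ []) ≡ 0
  tree⁺ σ Tσ = sum≡0⁺ _ (sequenceCode σ) λ k _ → trans (eval-position k σ) (position≡0 k (drop k σ) refl)
    where
    position≡0 : ∀ k ρ → drop k σ ≡ ρ → positionOf k σ (sequenceCode ρ) ≡ 0
    position≡0 k []      eq = refl
    position≡0 k (v ∷ ρ) eq = trans (positionOf-∷ k σ v ρ) (entry⁺ k v (sequenceCode σ) (Tσ k v ρ eq))

  tree⁻ : ∀ σ → eval treeᵗ (sequenceCode σ ∷ []) ≡ 0 → Tree σ
  tree⁻ σ eq k v ρ drop≡ = entry⁻ k v (sequenceCode σ) (begin
    eval entryᵗ (k ∷ v ∷ sequenceCode σ ∷ [])     ≡⟨ positionOf-∷ k σ v ρ ⟨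
    positionOf k σ (sequenceCode (v ∷ ρ))         ≡⟨ cong (positionOf k σ ∘ sequenceCode) drop≡ ⟨
    positionOf k σ (sequenceCode (drop k σ))      ≡⟨ eval-position k σ ⟨
    eval positionᵗ (k ∷ sequenceCode σ ∷ [])      ≡⟨ sum≡0⁻ _ (sequenceCode σ) eq k (drop-<-sequenceCode k σ drop≡) ⟩
    0                                             ∎)
    where open ≡-Reasoning

  tree-computable : Computable (codes Tree)
  tree-computable = programᵗ (notᵗ $ (treeᵗ ∷ [])) , λ x y χxy →
    subst (⟦ programᵗ (notᵗ $ (treeᵗ ∷ [])) ⟧ ∅ x) (value x y χxy) (programᵗ-correct (notᵗ $ (treeᵗ ∷ [])) ∅ x)
    where
    not-tree : ∀ x n → ¬ codes Tree x → eval treeᵗ (x ∷ []) ≡ n → eval notᵗ (n ∷ []) ≡ 0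
    -- Every number codes a sequence, so the value 0 puts `x` into the coded tree.
    not-tree x zero    x∉T eq with σ , refl ← sequenceCode-surjective x =
      contradiction (σ , refl , tree⁻ σ eq) x∉T
    not-tree x (suc n) x∉T eq = refl
    value : ∀ x y → χ (codes Tree) x y → eval notᵗ (eval treeᵗ (x ∷ []) ∷ []) ≡ y
    value x _ (inj₁ ((σ , refl , Tσ) , refl)) = cong (λ n → eval notᵗ (n ∷ [])) (tree⁺ σ Tσ)
    value x _ (inj₂ (x∉T , refl))             = not-tree x _ x∉T refl

  -- Only an entry 0 depends on the bound. Initial segments have smaller codes and hence inherit the
  -- condition.
  entry-antitone : ∀ x v {c c′} → c ≤ c′ → Entry x v c′ → Entry x v c
  entry-antitone x zero    c≤c′ none w w<c = none w (<-≤-trans w<c c≤c′)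
  entry-antitone x (suc w) c≤c′ e          = e

  isTree : IsTree Tree
  isTree σ τ (p , _) Tτ k v ρ eq with ρ′ , eq′ ← drop-prefix p k eq =
    entry-antitone k v (sequenceCode-mono p) (Tτ k v ρ′ eq′)

  -- The unique branch

  search : ∀ x n → (∃[ w ] Witness x w × NoWitnessBelow x w) ⊎ NoWitnessBelow x n
  search x zero    = inj₂ λ _ ()
  search x (suc n) with search x n
  ... | inj₁ found = inj₁ found
  ... | inj₂ none with eval witnessᵗ (x ∷ n ∷ []) ≟ 0
  ...   | yes wit = inj₁ (n , wit , none)
  ...   | no ¬wit = inj₂ λ w w<1+n → below w (m<1+n⇒m<n∨m≡n w<1+n)
    where
    below : ∀ w → w < n ⊎ w ≡ n → ¬ Witness x w
    below w (inj₁ w<n)  = none w w<n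
    below w (inj₂ refl) = ¬wit

  -- Excluded middle decides whether there is a witness at all; the least one is then found by
  -- bounded search.
  least : ∀ x → (∃[ w ] Witness x w × NoWitnessBelow x w) ⊎ (∀ w → ¬ Witness x w)
  least x with em {∃[ w ] Witness x w}
  ... | no ∄w = inj₂ λ w wit → ∄w (w , wit)
  ... | yes (w , wit) with search x (suc w)
  ...   | inj₁ found = inj₁ found
  ...   | inj₂ none  = contradiction wit (none w ≤-refl)

  branch : ℕ → ℕ
  branch x with least x
  ... | inj₁ (w , _) = suc w
  ... | inj₂ _       = 0

  branch-entry : ∀ x c → Entry x (branch x) c
  branch-entry x c with least x
  ... | inj₁ (_ , e) = e
  ... | inj₂ none    = λ w _ → none w

  -- Demanding the condition for every bound turns an entry 0 into the absence of all witnesses, and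
  -- least witnesses are unique.
  entries-agree : ∀ x u v → (∀ c → Entry x u c) → (∀ c → Entry x v c) → u ≡ v
  entries-agree x zero    zero    _  _  = refl
  entries-agree x zero    (suc w) eu ev = contradiction (proj₁ (ev 0)) (eu (suc w) w ≤-refl)
  entries-agree x (suc w) zero    eu ev = contradiction (proj₁ (eu 0)) (ev (suc w) w ≤-refl)
  entries-agree x (suc u) (suc v) eu ev with <-cmp u v | eu 0 | ev 0
  ... | tri< u<v _ _  | wit , _ | _ , none = contradiction wit (none u u<v)
  ... | tri≈ _ refl _ | _       | _        = refl
  ... | tri> _ _ v<u  | _ , none | wit , _ = contradiction wit (none v v<u)

  branch-isBranch : IsBranch Tree branch
  branch-isBranch n k v ρ eq with refl ← drop-applyUpTo⁻ branch n k eq = branch-entry k _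

  branch-unique : ∀ g → IsBranch Tree g → g ≗ branch
  branch-unique g Tg x = entries-agree x (g x) (branch x) entry-g (branch-entry x)
    where
    entry-g : ∀ c → Entry x (g x) c
    entry-g c
      -- This length makes both `x` and `c` positions: the first so that `g x` is constrained, the
      -- second so that the code exceeds `c`.
      with ρ , eq ← drop-applyUpTo⁺ g {suc (x + c)} {x} (s≤s (m≤m+n x c))
         | _ , eq′ ← drop-applyUpTo⁺ g {suc (x + c)} {c} (s≤s (m≤n+m c x)) =
      entry-antitone x (g x) (<⇒≤ (drop-<-sequenceCode c _ eq′)) (Tg (suc (x + c)) x (g x) ρ eq)

  finitelyBranching : FinitelyBranching Tree
  -- The bound is positive, so every entry from it on is positive too. Its condition then ignores
  -- `c` and forces it to equal `branch x`, which lies below the bound.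
  finitelyBranching σ _ = suc (branch x) , λ { (suc i) N≤i Tσi →
    <-irrefl (entries-agree x (branch x) (suc i) (branch-entry x)
                (λ _ → Tσi x (suc i) [] (drop-length-⋆ σ (suc i)))) N≤i }
    where x = length σ

  branch-positive : ∀ x w → Witness x w → branch x ≢ 0
  branch-positive x w wit branch≡0 =
    subst (λ v → Entry x v (suc w)) branch≡0 (branch-entry x (suc w)) w ≤-refl wit

  branch-zero : ∀ x → (∀ w → ¬ Witness x w) → branch x ≡ 0
  branch-zero x none = entries-agree x (branch x) 0 (branch-entry x) (λ _ w _ → none w)

  -- One query suffices: `π x 0` is in the graph iff `branch x` is 0, which means that `x` has no
  -- witness. `notᵗ` inverts the answer.
  branch-computes : ∀ {A : Pred ℕ 0ℓ} → (∀ x → A x → ∃[ w ] Witness x w) →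
                    (∀ x w → Witness x w → A x) → A ≤T graph branch
  branch-computes {A} complete sound =
    comp (programᵗ notᵗ) (comp oracle (programᵗ ⟨ v0 , 0ᵗ ⟩)) , computes
    where
    Z = graph branch
    in-graph : ∀ x → Z (π x 0) → branch x ≡ 0
    in-graph x (m , n , x,0≡m,n , bm≡n) = trans (cong branch (π-injectiveˡ {x} {0} {m} {n} x,0≡m,n))
      (trans bm≡n (sym (π-injectiveʳ {x} {0} {m} {n} x,0≡m,n)))
    computes : ∀ x y → χ A x y → ⟦ comp (programᵗ notᵗ) (comp oracle (programᵗ ⟨ v0 , 0ᵗ ⟩)) ⟧ Z x y
    computes x _ (inj₁ (Ax , refl)) with w , wit ← complete x Ax =
      0 , (π x 0 , programᵗ-correct ⟨ v0 , 0ᵗ ⟩ Z x ,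
           inj₂ (branch-positive x w wit ∘ in-graph x , refl)) , programᵗ-correct notᵗ Z 0
    computes x _ (inj₂ (¬Ax , refl)) =
      1 , (π x 0 , programᵗ-correct ⟨ v0 , 0ᵗ ⟩ Z x ,
           inj₁ ((x , 0 , refl , branch-zero x (λ w wit → ¬Ax (sound x w wit))) , refl)) ,
      programᵗ-correct notᵗ Z 1

theorem5p2p4 : ExcludedMiddle 0ℓ →
    Σ[ T ∈ Pred (List ℕ) 0ℓ ]
    IsTree T × Computable (codes T) × FinitelyBranching T ×
    (Σ[ f ∈ (ℕ → ℕ) ] IsBranch T f × (∀ g → IsBranch T g → g ≗ f) × ∅′ ≤T graph f)
theorem5p2p4 em =
  Tree , isTree , tree-computable , finitelyBranching ,
  branch , branch-isBranch , branch-unique , branch-computes ∅′⇒witness witness⇒∅′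
  where open LeastWitnessTree em haltingWitnessᵗ
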